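{- If $G=K_{1,1,p}$ with $p\geq 1$, then $G$ is ideally $3$-choosable and $3$-LISTCOL can be solved in $O(|V|)$ (for such graphs $G=(V,E)$).
   Context: All graphs are finite and simple. $K_{1,1,p}$ is the complete tripartite graph with parts of sizes $1,1,p$. For a graph $G=(V,E)$ and an assignment of lists $L(v)$ of colors to the vertices, a list coloring is a proper vertex coloring $c$ of $G$ with $c(v)\in L(v)$ for all $v\in V$. A graph $G=(V,E)$ is ideally $\ell$-choosable if for every assignment of lists $L(v)$ of colors with $|L(v)|=\ell$ for all $v\in V$, every vertex $v_0$ and every color $c_0\in L(v_0)$, there is a list coloring $c$ of $G$ with $c(v_0)=c_0$. $\ell$-LISTCOL is the following decision problem: given a graph $G=(V,E)$ and an assignment of lists $L(v)$ with $|L(v)|=\ell$ for all $v\in V$ (with no limitation on the total number of available colors), decide whether there is a list coloring. -}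

module Defs where

open import Data.Bool.Base using (if_then_else_)
open import Data.Fin.Base using (Fin; toℕ; splitAt)
open import Data.Fin.Patterns using (0F; 1F; 2F)
import Data.Fin.Properties as Fin
open import Data.List.Base
  using (List; []; _∷_; _++_; length; head; drop; filter; concatMap; allFin; cartesianProduct)
open import Data.List.Membership.Propositional using (_∈_)
open import Data.List.Relation.Binary.Permutation.Propositional using (_↭_)
open import Data.List.Relation.Unary.Unique.Propositional using (Unique)
open import Data.Maybe.Base using (Maybe; just; nothing; fromMaybe)
import Data.Maybe.Base as Maybe
open import Data.Nat.Base using (ℕ; suc; _+_; _∸_; _*_; _≤_; _≥_)
open import Data.Nat.Properties using (_≟_)
open import Data.Product.Base using (_×_; _,_; ∃-syntax; Σ-syntax)
open import Data.Sum.Base using (_⊎_; [_,_]′)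
open import Function.Base using (_∘_; const)
open import Function.Bundles using (_↔_; _⇔_; Inverse)
open import Relation.Binary.Core using (Rel)
open import Relation.Binary.Definitions using (Decidable; Symmetric; Irreflexive)
open import Relation.Binary.PropositionalEquality.Core using (_≡_; _≢_; refl; sym)
open import Relation.Nullary.Decidable.Core using (⌊_⌋; _×-dec_; ¬?)
open import Relation.Nullary.Negation.Core using (¬_)
open import Level using (0ℓ)

------------------------------------------------------------------------
-- Graphs

record Graph : Set₁ where
  field
    order      : ℕ
    Adj        : Rel (Fin order) 0ℓ
    adj?       : Decidable Adj
    adj-sym    : Symmetric Adj
    adj-irrefl : Irreflexive _≡_ Adj

  Vertex : Set
  Vertex = Fin order

open Graph public using (order; Adj; adj?; Vertex)

_≅_ : Graph → Graph → Set
G ≅ H = Σ[ f ∈ Vertex G ↔ Vertex H ]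
  (∀ u v → Adj G u v ⇔ Adj H (Inverse.to f u) (Inverse.to f v))

-- The first a vertices form part 0, the next b part 1, the last c part 2.
part : ∀ a b c → Fin (a + b + c) → Fin 3
part a b c v =
  [ [ const 0F , const 1F ]′ ∘ splitAt a , const 2F ]′ (splitAt (a + b) v)

completeTripartite : ℕ → ℕ → ℕ → Graph
completeTripartite a b c = record
  { order      = a + b + c
  ; Adj        = λ u v → part a b c u ≢ part a b c v
  ; adj?       = λ u v → ¬? (part a b c u Fin.≟ part a b c v)
  ; adj-sym    = λ u≢v → u≢v ∘ sym
  ; adj-irrefl = λ { refl u≢u → u≢u refl }
  }

-- Graphs are considered up to isomorphism, so the labelling of the vertices
-- does not reveal the tripartition.
IsK₁₁ₚ : Graph → Set
IsK₁₁ₚ G = ∃[ p ] p ≥ 1 × G ≅ completeTripartite 1 1 p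

------------------------------------------------------------------------
-- List colouring

Color : Set
Color = ℕ

-- A set of exactly ℓ colours is a duplicate-free list of length ℓ.
record ListAssignment (ℓ : ℕ) (G : Graph) : Set where
  field
    L        : Vertex G → List Color
    L-unique : ∀ v → Unique (L v)
    L-length : ∀ v → length (L v) ≡ ℓ

open ListAssignment public using (L)

record IsListColoring {ℓ} (G : Graph) (A : ListAssignment ℓ G)
                      (c : Vertex G → Color) : Set where
  field
    proper : ∀ u v → Adj G u v → c u ≢ c v
    inList : ∀ v → c v ∈ L A v

IdeallyChoosable : ℕ → Graph → Set
IdeallyChoosable ℓ G =
  ∀ (A : ListAssignment ℓ G) (v₀ : Vertex G) (c₀ : Color) → c₀ ∈ L A v₀ →
  ∃[ c ] IsListColoring G A c × c v₀ ≡ c₀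

------------------------------------------------------------------------
-- The random access machine with unit cost: unboundedly many registers and
-- memory cells holding natural numbers.  Only memory can be addressed
-- indirectly.  A machine halts when the program counter leaves the program.

Reg : Set
Reg = ℕ

data Instr : Set where
  set        : Reg → ℕ → Instr           -- R[r] := k
  move       : Reg → Reg → Instr         -- R[r] := R[s]
  add sub    : Reg → Reg → Reg → Instr   -- R[r] := R[s] ± R[t] (sub truncated at 0)
  load       : Reg → Reg → Instr         -- R[r] := M[R[s]]
  store      : Reg → Reg → Instr         -- M[R[r]] := R[s]
  jump       : ℕ → Instr
  jumpIfZero : Reg → ℕ → Instr

Program : Set
Program = List Instr

record Config : Set where
  constructor ⟨_,_,_⟩
  field
    pc  : ℕ
    reg : Reg → ℕ
    mem : ℕ → ℕ

open Config public

_[_≔_] : (ℕ → ℕ) → ℕ → ℕ → (ℕ → ℕ)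
(f [ i ≔ x ]) j = if ⌊ j ≟ i ⌋ then x else f j

exec : Instr → Config → Config
exec (set r k)        ⟨ i , R , M ⟩ = ⟨ suc i , R [ r ≔ k ] , M ⟩
exec (move r s)       ⟨ i , R , M ⟩ = ⟨ suc i , R [ r ≔ R s ] , M ⟩
exec (add r s t)      ⟨ i , R , M ⟩ = ⟨ suc i , R [ r ≔ R s + R t ] , M ⟩
exec (sub r s t)      ⟨ i , R , M ⟩ = ⟨ suc i , R [ r ≔ R s ∸ R t ] , M ⟩
exec (load r s)       ⟨ i , R , M ⟩ = ⟨ suc i , R [ r ≔ M (R s) ] , M ⟩
exec (store r s)      ⟨ i , R , M ⟩ = ⟨ suc i , R , M [ R r ≔ R s ] ⟩
exec (jump j)         ⟨ i , R , M ⟩ = ⟨ j , R , M ⟩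
exec (jumpIfZero r j) ⟨ i , R , M ⟩ = ⟨ (if ⌊ R r ≟ 0 ⌋ then j else suc i) , R , M ⟩

step : Program → Config → Maybe Config
step P s = Maybe.map (λ I → exec I s) (head (drop (pc s) P))

data _⊢_⇓[_]_ (P : Program) : Config → ℕ → Config → Set where
  halted : ∀ {s} → step P s ≡ nothing → P ⊢ s ⇓[ 0 ] s
  next   : ∀ {s s′ s″ t} → step P s ≡ just s′ →
           P ⊢ s′ ⇓[ t ] s″ → P ⊢ s ⇓[ suc t ] s″

-- The input word occupies memory cells 0, 1, 2, …; everything else is zero.
initial : List ℕ → Config
initial w = ⟨ 0 , const 0 , (λ i → fromMaybe 0 (head (drop i w))) ⟩

------------------------------------------------------------------------
-- Decision problems and time bounds

record DecisionProblem : Set₂ where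
  field
    Instance  : Set₁
    Yes       : Instance → Set
    _Encodes_ : List ℕ → Instance → Set

-- The answer is left in register 0.
Answers : Set → ℕ → Set
Answers Q b = (Q × b ≡ 1) ⊎ (¬ Q × b ≡ 0)

-- One program and one constant serve all instances satisfying the promise C,
-- with any of their encodings.
SolvableInO : (Π : DecisionProblem) →
              (C : DecisionProblem.Instance Π → Set) →
              (f : DecisionProblem.Instance Π → ℕ) → Set₁
SolvableInO Π C f =
  Σ[ P ∈ Program ] Σ[ k ∈ ℕ ]
  ∀ (I : Instance) → C I → ∀ (w : List ℕ) → w Encodes I →
  ∃[ t ] ∃[ s ] P ⊢ initial w ⇓[ t ] s × t ≤ k * f I × Answers (Yes I) (reg s 0)
  where
  open DecisionProblem Π

edges : (G : Graph) → List (Vertex G × Vertex G)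
edges G = filter (λ (u , v) → (u Fin.<? v) ×-dec adj? G u v)
                 (cartesianProduct (allFin (order G)) (allFin (order G)))

record ListColInstance (ℓ : ℕ) : Set₁ where
  constructor listCol
  field
    graph : Graph
    lists : ListAssignment ℓ graph

open ListColInstance public

-- Number of vertices, number of edges, the endpoints of the edges, and then
-- the ℓ colours of each vertex in turn.
encode : ∀ {ℓ} (I : ListColInstance ℓ) →
         List (Vertex (graph I) × Vertex (graph I)) → List ℕ
encode (listCol G A) es =
  order G ∷ length es ∷
  concatMap (λ (u , v) → toℕ u ∷ toℕ v ∷ []) es ++
  concatMap (L A) (allFin (order G))

-- The edges of the input may be listed in any order.
LISTCOL : ℕ → DecisionProblem
LISTCOL ℓ = record
  { Instance  = ListColInstance ℓ
  ; Yes       = λ (listCol G A) → ∃[ c ] IsListColoring G A c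
  ; _Encodes_ = λ w I → ∃[ es ] es ↭ edges (graph I) × w ≡ encode I es
  }

{-# OPTIONS --safe #-}

-- Three distinct colours always leave one outside any two forbidden ones.  So
-- K₁₁ₚ can be coloured greedily: first the two apexes, then the remaining
-- vertices, each of which sees only the apexes.  A prescribed colour at a
-- non-apex vertex merely has to be avoided at both apexes.  Since a colouring
-- always exists, the decision problem is solved by the constant answer "yes".

module Submission where

open import Defs
open import Data.Fin.Base using (Fin; zero; suc; _<_)
open import Data.Fin.Patterns using (0F; 1F)
import Data.Fin.Properties as Fin
open import Data.List.Base using (List; []; _∷_; length; lookup)
open import Data.List.Membership.DecPropositional using (_∈?_)
open import Data.List.Membership.Propositional using (_∈_; _∉_; find)
open import Data.List.Membership.Propositional.Properties using (∈-lookup)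
import Data.List.Membership.Setoid.Properties as Membership
import Data.List.Relation.Unary.All as All
open import Data.List.Relation.Unary.All.Properties using (¬All⇒Any¬)
open import Data.List.Relation.Unary.AllPairs using (AllPairs; _∷_)
open import Data.List.Relation.Unary.Any using (here; there; index)
open import Data.List.Relation.Unary.Unique.Propositional using (Unique)
open import Data.Nat.Base using (suc; s<s⁻¹)
import Data.Nat.Base as ℕ
import Data.Nat.Properties as ℕ
open import Data.Product.Base using (_×_; _,_; ∃-syntax; proj₁; proj₂)
open import Data.Sum.Base using (inj₁)
open import Function.Base using (_∘_)
open import Function.Bundles using (Equivalence; Inverse)
open import Relation.Binary.Core using (Rel)
open import Relation.Binary.PropositionalEquality
  using (_≡_; _≢_; refl; sym; subst; setoid)
open import Relation.Nullary using (yes; no; contradiction; ¬_)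

AllPairs-lookup : ∀ {a r} {A : Set a} {R : Rel A r} {xs : List A} →
                  AllPairs R xs → ∀ {i j} → i < j → R (lookup xs i) (lookup xs j)
AllPairs-lookup {xs = _ ∷ xs} (Rx ∷ _) {zero}  {suc j} _   = All.lookup Rx (∈-lookup {xs = xs} j)
AllPairs-lookup (_ ∷ Rxs)              {suc i} {suc j} i<j = AllPairs-lookup Rxs (s<s⁻¹ i<j)

Unique-longer⇒⊈ : ∀ {a} {A : Set a} {xs ys : List A} → Unique xs → length ys ℕ.< length xs →
                  ¬ All.All (_∈ ys) xs
Unique-longer⇒⊈ {A = A} {xs} uniq ys<xs xs⊆ys =
  let i , j , i<j , eq = Fin.pigeonhole ys<xs (index ∘ member)
  in AllPairs-lookup uniq i<j
       (Membership.index-injective (setoid A) (member i) (member j) eq)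
  where
  member = λ i → All.lookup xs⊆ys (∈-lookup {xs = xs} i)

∃-fresh : ∀ {xs ys : List Color} → Unique xs → length ys ℕ.< length xs →
          ∃[ c ] c ∈ xs × c ∉ ys
∃-fresh {xs} {ys} uniq ys<xs =
  find (¬All⇒Any¬ (λ c → _∈?_ ℕ._≟_ c ys) xs (Unique-longer⇒⊈ uniq ys<xs))

avoid₂ : ∀ {G} (A : ListAssignment 3 G) v (a b : Color) →
         ∃[ c ] c ∈ L A v × c ≢ a × c ≢ b
avoid₂ A v a b =
  let c , c∈ , c∉ = ∃-fresh {ys = a ∷ b ∷ []} (ListAssignment.L-unique A v)
                      (ℕ.≤-reflexive (sym (ListAssignment.L-length A v)))
  in c , c∈ , (c∉ ∘ here) , (c∉ ∘ there ∘ here)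

IdeallyChoosable-resp-≅ : ∀ {ℓ G H} → G ≅ H → IdeallyChoosable ℓ H → IdeallyChoosable ℓ G
IdeallyChoosable-resp-≅ {ℓ} {G} {H} (f , adj) choose A v₀ c₀ c₀∈ =
  let c , col , c≡c₀ = choose A′ (to v₀) c₀ (subst (λ v → c₀ ∈ L A v) (sym (from∘to v₀)) c₀∈)
      open IsListColoring col
  in c ∘ to
   , record
     { proper = λ u v uv → proper (to u) (to v) (Equivalence.to (adj u v) uv)
     ; inList = λ v → subst (λ u → c (to v) ∈ L A u) (from∘to v) (inList (to v))
     }
   , c≡c₀
  where
  open Inverse f using (to; from)

  from∘to : ∀ v → from (to v) ≡ v
  from∘to _ = Inverse.inverseʳ f refl

  A′ : ListAssignment ℓ H
  A′ = record
    { L        = L A ∘ from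
    ; L-unique = ListAssignment.L-unique A ∘ from
    ; L-length = ListAssignment.L-length A ∘ from
    }

module _ {p ℓ} (A : ListAssignment ℓ (completeTripartite 1 1 p)) where

  apexColoring : Color → Color → (Fin p → Color) → Vertex (completeTripartite 1 1 p) → Color
  apexColoring a b c 0F            = a
  apexColoring a b c 1F            = b
  apexColoring a b c (suc (suc i)) = c i

  apexColoring-isListColoring :
    ∀ {a b c} → a ∈ L A 0F → b ∈ L A 1F → a ≢ b →
    (∀ i → c i ∈ L A (suc (suc i)) × c i ≢ a × c i ≢ b) →
    IsListColoring _ A (apexColoring a b c)
  apexColoring-isListColoring {a} {b} {c} a∈ b∈ a≢b leaf = record
    { proper = proper ; inList = inList }
    where
    proper : ∀ u v → Adj (completeTripartite 1 1 p) u v →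
             apexColoring a b c u ≢ apexColoring a b c v
    proper 0F            0F            u≢v = contradiction refl u≢v
    proper 0F            1F            _   = a≢b
    proper 0F            (suc (suc j)) _   = proj₁ (proj₂ (leaf j)) ∘ sym
    proper 1F            0F            _   = a≢b ∘ sym
    proper 1F            1F            u≢v = contradiction refl u≢v
    proper 1F            (suc (suc j)) _   = proj₂ (proj₂ (leaf j)) ∘ sym
    proper (suc (suc i)) 0F            _   = proj₁ (proj₂ (leaf i))
    proper (suc (suc i)) 1F            _   = proj₂ (proj₂ (leaf i))
    proper (suc (suc i)) (suc (suc j)) u≢v = contradiction refl u≢v

    inList : ∀ v → apexColoring a b c v ∈ L A v
    inList 0F            = a∈
    inList 1F            = b∈
    inList (suc (suc i)) = proj₁ (leaf i)

K₁₁ₚ-ideallyChoosable : ∀ p → IdeallyChoosable 3 (completeTripartite 1 1 p)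
K₁₁ₚ-ideallyChoosable p A 0F c₀ c₀∈ =
  let b , b∈ , b≢c₀ , _ = avoid₂ A 1F c₀ c₀
      leaf i = avoid₂ A (suc (suc i)) c₀ b
  in apexColoring A c₀ b (proj₁ ∘ leaf)
   , apexColoring-isListColoring A c₀∈ b∈ (b≢c₀ ∘ sym) (proj₂ ∘ leaf)
   , refl
K₁₁ₚ-ideallyChoosable p A 1F c₀ c₀∈ =
  let a , a∈ , a≢c₀ , _ = avoid₂ A 0F c₀ c₀
      leaf i = avoid₂ A (suc (suc i)) a c₀
  in apexColoring A a c₀ (proj₁ ∘ leaf)
   , apexColoring-isListColoring A a∈ c₀∈ a≢c₀ (proj₂ ∘ leaf)
   , refl
K₁₁ₚ-ideallyChoosable p A (suc (suc i₀)) c₀ c₀∈ =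
  let a , a∈ , a≢c₀ , _    = avoid₂ A 0F c₀ c₀
      b , b∈ , b≢c₀ , b≢a  = avoid₂ A 1F c₀ a
      leaf = leafChoice (a≢c₀ ∘ sym) (b≢c₀ ∘ sym)
  in apexColoring A a b (proj₁ ∘ leaf)
   , apexColoring-isListColoring A a∈ b∈ (b≢a ∘ sym) (proj₁ ∘ proj₂ ∘ leaf)
   , proj₂ (proj₂ (leaf i₀)) refl
  where
  leafChoice : ∀ {a b} → c₀ ≢ a → c₀ ≢ b → ∀ i →
               ∃[ c ] (c ∈ L A (suc (suc i)) × c ≢ a × c ≢ b) × (i ≡ i₀ → c ≡ c₀)
  leafChoice {a} {b} c₀≢a c₀≢b i with i Fin.≟ i₀
  ... | yes refl = c₀ , (c₀∈ , c₀≢a , c₀≢b) , λ _ → refl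
  ... | no i≢i₀  =
    let c , c-ok = avoid₂ A (suc (suc i)) a b
    in c , c-ok , λ i≡i₀ → contradiction i≡i₀ i≢i₀

IsK₁₁ₚ⇒ideallyChoosable : ∀ G → IsK₁₁ₚ G → IdeallyChoosable 3 G
IsK₁₁ₚ⇒ideallyChoosable G (p , _ , G≅K) =
  IdeallyChoosable-resp-≅ {G = G} G≅K (K₁₁ₚ-ideallyChoosable p)

apex : ∀ G → IsK₁₁ₚ G → Vertex G
apex G (_ , _ , f , _) = Inverse.from f 0F

IdeallyChoosable⇒colorable : ∀ {ℓ G} → IdeallyChoosable (suc ℓ) G → Vertex G →
                             (A : ListAssignment (suc ℓ) G) → ∃[ c ] IsListColoring G A c
IdeallyChoosable⇒colorable choose v A with L A v in eq | ListAssignment.L-length A v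
... | c₀ ∷ _ | _ =
  let c , col , _ = choose A v c₀ (subst (c₀ ∈_) (sym eq) (here refl)) in c , col

corollary3p1 : (∀ (G : Graph) → IsK₁₁ₚ G → IdeallyChoosable 3 G) ×
    SolvableInO (LISTCOL 3) (λ I → IsK₁₁ₚ (graph I)) (λ I → order (graph I))
corollary3p1 = IsK₁₁ₚ⇒ideallyChoosable , set 0 1 ∷ [] , 1 , λ where
  (listCol G A) isK _ _ →
    let v = apex G isK
    in 1 , _ , next refl (halted refl)
     , ℕ.≤-trans (ℕ.>-nonZero⁻¹ (order G) ⦃ Fin.nonZeroIndex v ⦄)
         (ℕ.≤-reflexive (sym (ℕ.*-identityˡ (order G))))
     , inj₁ (IdeallyChoosable⇒colorable {G = G} (IsK₁₁ₚ⇒ideallyChoosable G isK) v A , refl)
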